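{- For the $k$-server problem and any $\varepsilon>0$, the bijective ratio of $\textsc{greedy}$ (against the optimal offline algorithm) is at least $\frac{k}{2}-\varepsilon$ on the line and at least $\frac{k}{3}-\varepsilon$ on the circle.
   Context: The line $[0,1]$ (resp. the circle of circumference 1) is modelled by a path (resp. cycle) with equally spaced vertices at spacing $\delta>0$, which may be arbitrarily small. $k$ servers occupy vertices; a request is a vertex to which an algorithm must move a server; cost is total distance moved; all algorithms start from the same initial configuration. $\mathcal{I}_n$ is the set of request sequences of length $n$, $A(\sigma)$ the cost of $A$ on $\sigma$. $\textsc{greedy}$ serves each request by moving the closest server. The bijective ratio of an online algorithm $A$ against algorithm $B$ is at most $\rho$ if there is $n_0$ such that for all $n\ge n_0$ there is a bijection $\pi:\mathcal{I}_n\to\mathcal{I}_n$ with $A(\sigma)\le\rho\cdot B(\pi(\sigma))$ for all $\sigma\in\mathcal{I}_n$ (asymptotic version: $A(\sigma)\le\rho\cdot B(\pi(\sigma))+c$ for a constant $c$ independent of $n$); the bijective ratio is the infimum of such $\rho$. -}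

module Defs where

open import Data.Nat as ℕ using (ℕ; zero; suc; _+_; _∸_; _⊓_; ∣_-_∣; _≤_; NonZero)
open import Data.Fin using (Fin; toℕ)
open import Data.List using (List; []; _∷_; map; concatMap; foldr; allFin)
open import Data.Vec using (Vec; []; _∷_; lookup; _[_]≔_)
open import Data.Product using (Σ; ∃; ∃-syntax; _×_; _,_)
open import Data.Integer using (+_)
open import Data.Rational using (ℚ; _/_; _*_; _-_; _<_) renaming (_≤_ to _≤ℚ_)
open import Function.Bundles using (Bijection; _⤖_)

-- Discretised metric spaces.  Distances are measured in units of the
-- spacing δ (i.e. multiplied by 1/δ); all costs scale by the same factor,
-- so inequalities  A ≤ ρ · B  are unaffected.

record Metric : Set where
  field
    V    : ℕ
    dist : Fin V → Fin V → ℕ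
open Metric public

-- The line [0,1] with spacing δ = 1/N : the path with vertices 0,1,…,N.
line : ℕ → Metric
line N = record { V = suc N ; dist = λ i j → ∣ toℕ i - toℕ j ∣ }

-- The circle of circumference 1 with spacing δ = 1/N : the cycle on N vertices.
circle : ℕ → Metric
circle N = record { V = N ; dist = λ i j → ∣ toℕ i - toℕ j ∣ ⊓ (N ∸ ∣ toℕ i - toℕ j ∣) }

module _ (M : Metric) (k : ℕ) where

  Vertex : Set
  Vertex = Fin (V M)

  Config : Set
  Config = Vec Vertex k

  Requests : ℕ → Set
  Requests n = Vec Vertex n

  -- GREEDY: serve each request by moving (only) a closest server.
  -- Ties may be broken arbitrarily, possibly depending on the history.
  record GreedyRule : Set where
    field
      choose  : List Vertex → Config → Vertex → Fin k
      closest : ∀ hist C r (j : Fin k) →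
                dist M (lookup C (choose hist C r)) r ≤ dist M (lookup C j) r
  open GreedyRule public

  greedyFrom : GreedyRule → List Vertex → Config → ∀ {n} → Requests n → ℕ
  greedyFrom g hist C [] = 0
  greedyFrom g hist C (r ∷ rs) =
    let j = choose g hist C r in
    dist M (lookup C j) r + greedyFrom g (r ∷ hist) (C [ j ]≔ r) rs

  greedyCost : GreedyRule → Config → ∀ {n} → Requests n → ℕ
  greedyCost g C₀ σ = greedyFrom g [] C₀ σ

  -- OPT: the minimum, over all offline schedules (sequences of
  -- configurations C₁,…,Cₙ with the i-th request occupied in Cᵢ), of the
  -- total distance moved  Σᵢ Σⱼ dist (Cᵢ₋₁ j) (Cᵢ j).

  allVecs : (m : ℕ) → List (Vec Vertex m)
  allVecs zero    = [] ∷ []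
  allVecs (suc m) = concatMap (λ x → map (x ∷_) (allVecs m)) (allFin (V M))

  allConfigs : List Config
  allConfigs = allVecs k

  -- all configurations in which some server occupies r
  -- (every such configuration is D [ j ]≔ r for some D and j)
  configsAt : Vertex → List Config
  configsAt r = concatMap (λ D → map (λ j → D [ j ]≔ r) (allFin k)) allConfigs

  moveCost : ∀ {m} → Vec Vertex m → Vec Vertex m → ℕ
  moveCost []       []       = 0
  moveCost (x ∷ xs) (y ∷ ys) = dist M x y + moveCost xs ys

  -- minimum of a list (the value on the empty list is irrelevant:
  -- for k ≥ 1 the list configsAt r is never empty)
  minimum : List ℕ → ℕ
  minimum []       = 0
  minimum (x ∷ xs) = foldr _⊓_ x xs

  optFrom : Config → ∀ {n} → Requests n → ℕ
  optFrom C [] = 0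
  optFrom C (r ∷ rs) = minimum (map (λ C′ → moveCost C C′ + optFrom C′ rs) (configsAt r))

  optCost : Config → ∀ {n} → Requests n → ℕ
  optCost C₀ σ = optFrom C₀ σ

  toℚ : ℕ → ℚ
  toℚ n = + n / 1

  BijRatioAtMost : GreedyRule → Config → ℚ → Set
  BijRatioAtMost g C₀ ρ =
    ∃[ n₀ ] ∀ n → n₀ ≤ n →
      Σ (Requests n ⤖ Requests n) λ π → ∀ (σ : Requests n) →
        toℚ (greedyCost g C₀ σ) ≤ℚ ρ * toℚ (optCost C₀ (Bijection.to π σ))

  BijRatioAtLeast : GreedyRule → Config → ℚ → Set
  BijRatioAtLeast g C₀ x = ∀ ρ → BijRatioAtMost g C₀ ρ → x ≤ℚ ρ

{-# OPTIONS --safe #-}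

-- A bijection matches every request sequence with some other one, so it suffices
-- to compare one bad sequence for GREEDY with an upper bound on OPT valid for all
-- sequences.  Place one server at p and the others at b, and request s, p, s, p, …
-- where p and s are closer to each other than to b: GREEDY then moves a single
-- server forever and pays d = dist p s per request.  One can take d ≈ N/2 on the
-- line and d ≈ N/3 on the circle.  Dedicating one server to each of k intervals of
-- length L ≈ N/k serves any n requests at cost at most kN + nL.  Hence the ratio
-- is at least about d/L once n is large.
module Submission where

open import Defs
open import Data.Nat as ℕ using (ℕ; zero; suc; z≤n; s≤s; _≤_; NonZero; ∣_-_∣)
import Data.Nat.Properties as ℕ
open import Data.Nat.DivMod using (m≡m%n+[m/n]*n; m%n<n; m/n*n≤m; m*n/n≡m; /-monoˡ-≤; m<n*o⇒m/o<n)
import Data.Nat.Coprimality as Coprime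
open Coprime using (1-coprimeTo)
open import Data.Nat.Tactic.RingSolver using (solve-∀)
open import Data.Fin as Fin using (Fin; toℕ; fromℕ<)
import Data.Fin.Properties as Fin
open import Data.Vec using (Vec; []; _∷_; lookup; _[_]≔_; replicate; tabulate)
open import Data.Vec.Properties using (lookup∘update; lookup∘update′; lookup∘tabulate; lookup-replicate)
open import Data.List as List using ([]; _∷_; allFin)
open import Data.List.Membership.Propositional using (_∈_; lose)
open import Data.List.Membership.Propositional.Properties
  using (∈-concatMap⁺; ∈-map⁺; ∈-allFin)
open import Data.List.Relation.Unary.Any using (here; there)
open import Data.Product using (∃-syntax; _×_; _,_; proj₁; proj₂)
open import Data.Sum using (inj₁; inj₂)
open import Data.Integer as ℤ using (+_; +[1+_])
import Data.Integer.Properties as ℤ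
open import Data.Rational as ℚ using (ℚ; mkℚ; 0ℚ; _/_; _-_; _<_)
import Data.Rational.Properties as ℚ
import Data.Rational.Unnormalised as ℚᵘ
import Data.Rational.Unnormalised.Properties as ℚᵘ
open import Data.Rational.Solver using (module +-*-Solver)
open import Function.Bundles using (Bijection)
open import Relation.Nullary using (yes; no; contradiction)
open import Relation.Binary.PropositionalEquality

-- Cost of GREEDY on an alternating sequence.

module _ (M : Metric) (k : ℕ) where

  -- The first request is `q`, since `p` is where the moving server stands.
  alternating : Vertex M k → Vertex M k → ∀ n → Requests M k n
  alternating p q zero    = []
  alternating p q (suc n) = q ∷ alternating q p n

module _ (M : Metric) {k : ℕ} (g : GreedyRule M (suc k)) (b : Fin (V M)) {d : ℕ} where

  -- The servers at `b` are strictly farther from the request than the moving one, so no tie occurs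
  -- and every rule picks server `0`. The new configuration has the same shape with `p` and `q`
  -- exchanged.
  alternating≤greedy : ∀ hist p q → dist M p q ≡ d → dist M q p ≡ d →
    d ℕ.< dist M b p → d ℕ.< dist M b q → ∀ n →
    n ℕ.* d ≤ greedyFrom M (suc k) g hist (p ∷ replicate k b) (alternating M (suc k) p q n)
  alternating≤greedy hist p q pq qp bp bq zero = z≤n
  alternating≤greedy hist p q pq qp bp bq (suc n)
    with choose g hist (p ∷ replicate k b) q | closest g hist (p ∷ replicate k b) q Fin.zero
  ... | Fin.zero  | _ =
    ℕ.+-mono-≤ (ℕ.≤-reflexive (sym pq)) (alternating≤greedy (q ∷ hist) q p qp pq bq bp n)
  ... | Fin.suc i | nearest =
    contradiction (subst₂ ℕ._≤_ (cong (λ x → dist M x q) (lookup-replicate i b)) pq nearest)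
                  (ℕ.<⇒≱ bq)

-- Upper bounds on OPT from explicit schedules.

module _ (M : Metric) (k : ℕ) where

  ∈-allVecs : ∀ {m} (xs : Vec (Vertex M k) m) → xs ∈ allVecs M k m
  ∈-allVecs []       = here refl
  ∈-allVecs (x ∷ xs) =
    ∈-concatMap⁺ (λ y → List.map (y ∷_) (allVecs M k _))
      (lose (∈-allFin x) (∈-map⁺ (x ∷_) (∈-allVecs xs)))

  ∈-configsAt : ∀ (D : Config M k) j r → (D [ j ]≔ r) ∈ configsAt M k r
  ∈-configsAt D j r =
    ∈-concatMap⁺ (λ E → List.map (λ i → E [ i ]≔ r) (allFin k))
      (lose (∈-allVecs D) (∈-map⁺ (λ i → D [ i ]≔ r) (∈-allFin j)))

  minimum≤ : ∀ {x xs} → x ∈ xs → minimum M k xs ≤ x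
  minimum≤ {xs = y ∷ ys} = go ys
    where
    go : ∀ {x} ys → x ∈ y ∷ ys → List.foldr ℕ._⊓_ y ys ≤ x
    go []       (here refl)         = ℕ.≤-refl
    go (z ∷ ys) (here refl)         = ℕ.≤-trans (ℕ.m⊓n≤n z _) (go ys (here refl))
    go (z ∷ ys) (there (here refl)) = ℕ.m⊓n≤m z _
    go (z ∷ ys) (there (there x∈))  = ℕ.≤-trans (ℕ.m⊓n≤n z _) (go ys (there x∈))

  -- `D` is unrelated to `C`: one step may relocate all servers, which allows a start from an
  -- arbitrary configuration.
  optFrom-step : ∀ C D j r {n} (rs : Requests M k n) →
    optFrom M k C (r ∷ rs) ≤
    moveCost M k C (D [ j ]≔ r) ℕ.+ optFrom M k (D [ j ]≔ r) rs
  optFrom-step C D j r rs =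
    minimum≤ (∈-map⁺ (λ E → moveCost M k C E ℕ.+ optFrom M k E rs) (∈-configsAt D j r))

  moveCost≤ : ∀ {v} → (∀ x y → dist M x y ≤ v) →
    ∀ {m} (xs ys : Vec (Vertex M k) m) → moveCost M k xs ys ≤ m ℕ.* v
  moveCost≤ diam []       []       = z≤n
  moveCost≤ diam (x ∷ xs) (y ∷ ys) = ℕ.+-mono-≤ (diam x y) (moveCost≤ diam xs ys)

  module _ (dist-self : ∀ x → dist M x x ≡ 0) where

    moveCost-self : ∀ {m} (xs : Vec (Vertex M k) m) → moveCost M k xs xs ≡ 0
    moveCost-self []       = refl
    moveCost-self (x ∷ xs) = cong₂ ℕ._+_ (dist-self x) (moveCost-self xs)

    moveCost-update : ∀ {m} (xs : Vec (Vertex M k) m) j r →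
      moveCost M k xs (xs [ j ]≔ r) ≡ dist M (lookup xs j) r
    moveCost-update (x ∷ xs) Fin.zero    r =
      trans (cong (dist M x r ℕ.+_) (moveCost-self xs)) (ℕ.+-identityʳ _)
    moveCost-update (x ∷ xs) (Fin.suc j) r =
      cong₂ ℕ._+_ (dist-self x) (moveCost-update xs j r)

    -- One server is dedicated to each of k blocks of diameter at most L.
    module _ {L : ℕ} (block : Vertex M k → Fin k)
             (block-diam : ∀ r s → block r ≡ block s → dist M r s ≤ L) where

      -- Quantifying over requests leaves the servers of empty blocks unconstrained.
      Balanced : Config M k → Set
      Balanced D = ∀ r → dist M (lookup D (block r)) r ≤ L

      balanced-update : ∀ D → Balanced D → ∀ r → Balanced (D [ block r ]≔ r)
      balanced-update D bal r s with block s Fin.≟ block r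
      ... | yes eq rewrite eq | lookup∘update (block r) D r = block-diam r s (sym eq)
      ... | no neq rewrite lookup∘update′ neq D r = bal s

      optFrom-balanced : ∀ D → Balanced D → ∀ {n} (rs : Requests M k n) →
        optFrom M k D rs ≤ n ℕ.* L
      optFrom-balanced D bal [] = z≤n
      optFrom-balanced D bal (r ∷ rs) =
        ℕ.≤-trans (optFrom-step D D (block r) r rs)
          (ℕ.+-mono-≤
            (ℕ.≤-trans (ℕ.≤-reflexive (moveCost-update D (block r) r)) (bal r))
            (optFrom-balanced _ (balanced-update D bal r) rs))

      optCost-balanced : ∀ {v} → (∀ x y → dist M x y ≤ v) → ∀ D → Balanced D →
        ∀ C {n} (rs : Requests M k n) → optCost M k C rs ≤ k ℕ.* v ℕ.+ n ℕ.* L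
      optCost-balanced diam D bal C [] = z≤n
      optCost-balanced diam D bal C (r ∷ rs) =
        -- The first request is served by relocating all servers, at cost at most `k * v`; its share
        -- `L` of the bound is left unspent.
        ℕ.≤-trans (optFrom-step C D (block r) r rs)
          (ℕ.+-mono-≤ (moveCost≤ diam C _)
            (ℕ.≤-trans (optFrom-balanced _ (balanced-update D bal r) rs) (ℕ.m≤n+m _ L)))

-- Blocks as intervals of vertices.

∣-∣≤ : ∀ {x y o L} → o ≤ x → o ≤ y → x ≤ o ℕ.+ L → y ≤ o ℕ.+ L → ∣ x - y ∣ ≤ L
∣-∣≤ {x} {y} {o} {L} o≤x o≤y x≤ y≤ with ℕ.≤-total x y
... | inj₁ x≤y rewrite ℕ.m≤n⇒∣m-n∣≡n∸m x≤y =
  ℕ.≤-trans (ℕ.∸-mono y≤ o≤x) (ℕ.≤-reflexive (ℕ.m+n∸m≡n o L))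
... | inj₂ y≤x rewrite ℕ.m≤n⇒∣n-m∣≡n∸m y≤x =
  ℕ.≤-trans (ℕ.∸-mono x≤ o≤y) (ℕ.≤-reflexive (ℕ.m+n∸m≡n o L))

/-block-upper : ∀ m n .{{_ : NonZero n}} → m ≤ (m ℕ./ n) ℕ.* n ℕ.+ n
/-block-upper m n = begin
  m                             ≡⟨ m≡m%n+[m/n]*n m n ⟩
  m ℕ.% n ℕ.+ m ℕ./ n ℕ.* n     ≤⟨ ℕ.+-monoˡ-≤ _ (ℕ.<⇒≤ (m%n<n m n)) ⟩
  n ℕ.+ m ℕ./ n ℕ.* n           ≡⟨ ℕ.+-comm n _ ⟩
  m ℕ./ n ℕ.* n ℕ.+ n           ∎
  where open ℕ.≤-Reasoning

-- Only an upper bound on the distance matters, so the line and the circle are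
-- both covered by cutting 0,…,v into k intervals.
optCost-upper : ∀ {v} (dst : Fin (suc v) → Fin (suc v) → ℕ) →
  (∀ i j → dst i j ≤ ∣ toℕ i - toℕ j ∣) →
  ∀ {k L} .{{_ : NonZero L}} → v ℕ.< k ℕ.* L →
  ∀ C {n} (rs : Requests (record { V = suc v ; dist = dst }) k n) →
  optCost (record { V = suc v ; dist = dst }) k C rs ≤ k ℕ.* v ℕ.+ n ℕ.* L
optCost-upper {v} dst dst≤ {k} {L} v<kL =
  optCost-balanced _ k dst-self block block-diam diam (tabulate start) start-balanced
  where
  v≥ : ∀ (i : Fin (suc v)) → toℕ i ≤ v
  v≥ i = ℕ.≤-pred (Fin.toℕ<n i)

  dst-self : ∀ x → dst x x ≡ 0
  dst-self x = ℕ.n≤0⇒n≡0 (ℕ.≤-trans (dst≤ x x) (ℕ.≤-reflexive (ℕ.∣n-n∣≡0 (toℕ x))))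

  diam : ∀ x y → dst x y ≤ v
  diam x y = ℕ.≤-trans (dst≤ x y) (∣-∣≤ z≤n z≤n (v≥ x) (v≥ y))

  -- The strict bound on `v` gives even the last vertex a block index below `k`.
  block< : ∀ (r : Fin (suc v)) → toℕ r ℕ./ L ℕ.< k
  block< r = m<n*o⇒m/o<n (ℕ.≤-<-trans (v≥ r) v<kL)

  block : Fin (suc v) → Fin k
  block r = fromℕ< (block< r)

  toℕ-block : ∀ r → toℕ (block r) ≡ toℕ r ℕ./ L
  toℕ-block r = Fin.toℕ-fromℕ< (block< r)

  lower : ∀ r → toℕ (block r) ℕ.* L ≤ toℕ r
  lower r rewrite toℕ-block r = m/n*n≤m (toℕ r) L

  upper : ∀ r → toℕ r ≤ toℕ (block r) ℕ.* L ℕ.+ L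
  upper r rewrite toℕ-block r = /-block-upper (toℕ r) L

  block-diam : ∀ r s → block r ≡ block s → dst r s ≤ L
  block-diam r s eq = ℕ.≤-trans (dst≤ r s)
    (∣-∣≤ (lower r) (subst (λ j → toℕ j ℕ.* L ≤ toℕ s) (sym eq) (lower s))
          (upper r) (subst (λ j → toℕ s ≤ toℕ j ℕ.* L ℕ.+ L) (sym eq) (upper s)))

  -- The last blocks may be empty, in which case jL exceeds v.
  start : Fin k → Fin (suc v)
  start j = fromℕ< (s≤s (ℕ.m⊓n≤n (toℕ j ℕ.* L) v))

  -- A block that contains `r` starts at or before `r`, hence within `v`, so the truncation in
  -- `start` has no effect on it.
  toℕ-start : ∀ r → toℕ (start (block r)) ≡ toℕ (block r) ℕ.* L
  toℕ-start r = trans (Fin.toℕ-fromℕ< (s≤s (ℕ.m⊓n≤n (toℕ (block r) ℕ.* L) v))) (ℕ.m≤n⇒m⊓n≡m (ℕ.≤-trans (lower r) (v≥ r)))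

  start-balanced : ∀ r → dst (lookup (tabulate start) (block r)) r ≤ L
  start-balanced r rewrite lookup∘tabulate start (block r) =
    ℕ.≤-trans (dst≤ _ r) (subst (λ x → ∣ x - toℕ r ∣ ≤ L) (sym (toℕ-start r))
      (∣-∣≤ ℕ.≤-refl (lower r) (ℕ.m≤m+n _ L) (upper r)))

-- Rational arithmetic: from cost bounds to a bound on the ratio.

ι : ℕ → ℚ
ι n = + n / 1

-- The constructor form lets sums, products and comparisons of rationals compute.
ι-mkℚ : ∀ n → ι n ≡ mkℚ (+ n) 0 (Coprime.sym (1-coprimeTo n))
ι-mkℚ n = ℚ.normalize-coprime (Coprime.sym (1-coprimeTo n))

ι-+ : ∀ m n → ι (m ℕ.+ n) ≡ ι m ℚ.+ ι n
ι-+ m n = sym (trans (cong₂ ℚ._+_ (ι-mkℚ m) (ι-mkℚ n))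
  (cong (_/ 1) (cong₂ ℤ._+_ (ℤ.*-identityʳ (+ m)) (ℤ.*-identityʳ (+ n)))))

ι-* : ∀ m n → ι (m ℕ.* n) ≡ ι m ℚ.* ι n
ι-* m n = sym (trans (cong₂ ℚ._*_ (ι-mkℚ m) (ι-mkℚ n))
  (cong (_/ 1) (sym (ℤ.pos-* m n))))

ι-mono-≤ : ∀ m n → m ≤ n → ι m ℚ.≤ ι n
ι-mono-≤ m n m≤n = subst₂ ℚ._≤_ (sym (ι-mkℚ m)) (sym (ι-mkℚ n))
  (ℚ.*≤* (subst₂ ℤ._≤_ (sym (ℤ.*-identityʳ (+ m))) (sym (ℤ.*-identityʳ (+ n))) (ℤ.+≤+ m≤n)))

ι-nonNeg : ∀ n → ℚ.NonNegative (ι n)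
ι-nonNeg n = ℚ.normalize-nonNeg n 1

ι-pos : ∀ n .{{_ : NonZero n}} → ℚ.Positive (ι n)
ι-pos n = ℚ.normalize-pos n 1

-- Passing to unnormalised rationals turns the claim into a cross multiplication, free of gcds.
/-*-cancel : ∀ i n .{{_ : NonZero n}} → (i / n) ℚ.* ι n ≡ i / 1
/-*-cancel i (suc n) = ℚ.toℚᵘ-injective (begin
  ℚ.toℚᵘ ((i / suc n) ℚ.* ι (suc n))             ≈⟨ ℚ.toℚᵘ-homo-* (i / suc n) (ι (suc n)) ⟩
  ℚ.toℚᵘ (i / suc n) ℚᵘ.* ℚ.toℚᵘ (ι (suc n))
    ≈⟨ ℚᵘ.*-cong (ℚ.toℚᵘ-fromℚᵘ (ℚᵘ.mkℚᵘ i n)) (ℚ.toℚᵘ-fromℚᵘ (ℚᵘ.mkℚᵘ +[1+ n ] 0)) ⟩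
  ℚᵘ.mkℚᵘ i n ℚᵘ.* ℚᵘ.mkℚᵘ +[1+ n ] 0
    ≈⟨ ℚᵘ.*≡* (trans (ℤ.*-identityʳ _) (cong (λ m → i ℤ.* +[1+ m ]) (sym (ℕ.*-identityʳ n)))) ⟩
  ℚᵘ.mkℚᵘ i 0                                    ≈⟨ ℚ.toℚᵘ-fromℚᵘ (ℚᵘ.mkℚᵘ i 0) ⟨
  ℚ.toℚᵘ (i / 1)                                 ∎)
  where open import Relation.Binary.Reasoning.Setoid ℚᵘ.≃-setoid

-- `ε` times its denominator is its numerator, a positive integer.
pos⇒1≤*↧ : ∀ ε → 0ℚ < ε → ι 1 ℚ.≤ ε ℚ.* ι (ℚ.↧ₙ ε)
pos⇒1≤*↧ ε@(mkℚ +[1+ a ] b c) 0<ε = ℚ.≤-trans (ι-mono-≤ 1 (suc a) (s≤s z≤n)) (ℚ.≤-reflexive (sym (begin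
  ε ℚ.* ι (suc b)                         ≡⟨ cong (ℚ._* ι (suc b)) (ℚ.↥p/↧p≡p ε) ⟨
  (+[1+ a ] / suc b) ℚ.* ι (suc b)        ≡⟨ /-*-cancel +[1+ a ] (suc b) ⟩
  ι (suc a)                               ∎)))
  where open ≡-Reasoning
pos⇒1≤*↧ (mkℚ (+ 0)       _ _) (ℚ.*<* (ℤ.+<+ ()))
pos⇒1≤*↧ (mkℚ (ℤ.-[1+_] _) _ _) (ℚ.*<* ())

-- The conclusion k/q − ε ≤ ρ once b is the denominator of ε, so that ε ≥ 1/b;
-- the last hypothesis is (k/q − 1/b)·T ≤ P with denominators cleared.
ratio-bound : ∀ k q .{{_ : NonZero q}} ε → 0ℚ < ε → ∀ ρ {P G O T} →
  1 ≤ P → P ≤ G → O ≤ T → ι G ℚ.≤ ρ ℚ.* ι O →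
  k ℕ.* ℚ.↧ₙ ε ℕ.* T ≤ q ℕ.* ℚ.↧ₙ ε ℕ.* P ℕ.+ q ℕ.* T →
  (+ k / q) - ε ℚ.≤ ρ
ratio-bound k q@(suc _) ε 0<ε ρ {suc P} {G} {O} {T} _ P≤G O≤T G≤ρO cleared
  with (+ k / q) - ε ℚ.≤? ρ
... | yes x≤ρ = x≤ρ
... | no  x≰ρ = contradiction main (ℚ.<-irrefl refl)
  where
  b = ℚ.↧ₙ ε
  κ = + k / q
  x = κ - ε

  0<P : 0ℚ ℚ.< ι (suc P)
  0<P = ℚ.positive⁻¹ (ι (suc P)) {{ι-pos (suc P)}}

  P≤ρO : ι (suc P) ℚ.≤ ρ ℚ.* ι O
  P≤ρO = ℚ.≤-trans (ι-mono-≤ (suc P) G P≤G) G≤ρO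

  -- This lets the unknown `O` be replaced by its upper bound `T`. If `ρ ≤ 0`, then `ρ * O ≤ 0`,
  -- below the positive lower bound on GREEDY.
  0≤ρ : 0ℚ ℚ.≤ ρ
  0≤ρ with ℚ.≤-total 0ℚ ρ
  ... | inj₁ 0≤ρ = 0≤ρ
  ... | inj₂ ρ≤0 = contradiction
    (ℚ.<-≤-trans (0<P) (ℚ.≤-trans P≤ρO
      (ℚ.≤-trans (ℚ.*-monoʳ-≤-nonNeg (ι O) {{ι-nonNeg O}} ρ≤0) (ℚ.≤-reflexive (ℚ.*-zeroˡ (ι O))))))
    (ℚ.<-irrefl refl)

  P≤ρT : ι (suc P) ℚ.≤ ρ ℚ.* ι T
  P≤ρT = ℚ.≤-trans P≤ρO (ℚ.*-monoˡ-≤-nonNeg ρ {{ℚ.nonNegative 0≤ρ}} (ι-mono-≤ O T O≤T))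

  ρT<xT : ∀ T → ι (suc P) ℚ.≤ ρ ℚ.* ι T → ρ ℚ.* ι T ℚ.< x ℚ.* ι T
  ρT<xT zero    le = contradiction
    (ℚ.<-≤-trans (0<P) (ℚ.≤-trans le (ℚ.≤-reflexive (ℚ.*-zeroʳ ρ))))
    (ℚ.<-irrefl refl)
  ρT<xT (suc T) le = ℚ.*-monoˡ-<-pos (ι (suc T)) {{ι-pos (suc T)}} (ℚ.≰⇒> x≰ρ)

  rearrange : ∀ κ ε B Q T → (Q ℚ.* B) ℚ.* ((κ - ε) ℚ.* T) ℚ.+ (ε ℚ.* B) ℚ.* (Q ℚ.* T) ≡ (κ ℚ.* Q) ℚ.* B ℚ.* T
  rearrange = solve 5 (λ κ ε B Q T →
    (Q :* B) :* ((κ :- ε) :* T) :+ (ε :* B) :* (Q :* T) := (κ :* Q) :* B :* T) refl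
    where open +-*-Solver

  ι-*₃ : ∀ l m n → ι (l ℕ.* m ℕ.* n) ≡ ι l ℚ.* ι m ℚ.* ι n
  ι-*₃ l m n = trans (ι-* (l ℕ.* m) n) (cong (ℚ._* ι n) (ι-* l m))

  -- With `ρ < x` the chain of inequalities closes into a strict cycle. The bound `1 ≤ ε * b` trades
  -- `q * T` for `ε * b * q * T`, which cancels the `ε` inside `x`.
  main : ι (q ℕ.* b ℕ.* suc P ℕ.+ q ℕ.* T) ℚ.< ι (q ℕ.* b ℕ.* suc P ℕ.+ q ℕ.* T)
  main = begin-strict
    ι (q ℕ.* b ℕ.* suc P ℕ.+ q ℕ.* T)
      ≡⟨ ι-+ (q ℕ.* b ℕ.* suc P) (q ℕ.* T) ⟩
    ι (q ℕ.* b ℕ.* suc P) ℚ.+ ι (q ℕ.* T)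
      ≡⟨ cong (ℚ._+ ι (q ℕ.* T)) (ι-* (q ℕ.* b) (suc P)) ⟩
    ι (q ℕ.* b) ℚ.* ι (suc P) ℚ.+ ι (q ℕ.* T)
      <⟨ ℚ.+-monoˡ-< (ι (q ℕ.* T)) (ℚ.*-monoʳ-<-pos (ι (q ℕ.* b)) {{ι-pos (q ℕ.* b)}} (ℚ.≤-<-trans P≤ρT (ρT<xT T P≤ρT))) ⟩
    ι (q ℕ.* b) ℚ.* (x ℚ.* ι T) ℚ.+ ι (q ℕ.* T)
      ≡⟨ cong (ι (q ℕ.* b) ℚ.* (x ℚ.* ι T) ℚ.+_) (ℚ.*-identityˡ (ι (q ℕ.* T))) ⟨
    ι (q ℕ.* b) ℚ.* (x ℚ.* ι T) ℚ.+ ι 1 ℚ.* ι (q ℕ.* T)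
      ≤⟨ ℚ.+-monoʳ-≤ (ι (q ℕ.* b) ℚ.* (x ℚ.* ι T)) (ℚ.*-monoʳ-≤-nonNeg (ι (q ℕ.* T)) {{ι-nonNeg (q ℕ.* T)}} (pos⇒1≤*↧ ε 0<ε)) ⟩
    ι (q ℕ.* b) ℚ.* (x ℚ.* ι T) ℚ.+ (ε ℚ.* ι b) ℚ.* ι (q ℕ.* T)
      ≡⟨ cong₂ (λ y z → y ℚ.* (x ℚ.* ι T) ℚ.+ (ε ℚ.* ι b) ℚ.* z) (ι-* q b) (ι-* q T) ⟩
    (ι q ℚ.* ι b) ℚ.* (x ℚ.* ι T) ℚ.+ (ε ℚ.* ι b) ℚ.* (ι q ℚ.* ι T)
      ≡⟨ rearrange κ ε (ι b) (ι q) (ι T) ⟩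
    (κ ℚ.* ι q) ℚ.* ι b ℚ.* ι T
      ≡⟨ cong (λ y → y ℚ.* ι b ℚ.* ι T) (/-*-cancel (+ k) q) ⟩
    ι k ℚ.* ι b ℚ.* ι T
      ≡⟨ ι-*₃ k b T ⟨
    ι (k ℕ.* b ℕ.* T)
      ≤⟨ ι-mono-≤ (k ℕ.* b ℕ.* T) (q ℕ.* b ℕ.* suc P ℕ.+ q ℕ.* T) cleared ⟩
    ι (q ℕ.* b ℕ.* suc P ℕ.+ q ℕ.* T)
      ∎
    where open ℚ.≤-Reasoning

-- Here `K + n * L` bounds OPT and `n * d` bounds GREEDY. Since `n` is large, the startup term
-- contributes at most `b * n`; since `L` is large, all errors together, `n * (1 + c) * b`, are at
-- most `n * L`.
cleared-bound : ∀ {k q b c d K L n} → 1 ≤ q → k ℕ.* L ≤ q ℕ.* d ℕ.+ c → (1 ℕ.+ c) ℕ.* b ≤ L →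
  k ℕ.* K ≤ n → k ℕ.* b ℕ.* (K ℕ.+ n ℕ.* L) ≤ q ℕ.* b ℕ.* (n ℕ.* d) ℕ.+ q ℕ.* (K ℕ.+ n ℕ.* L)
cleared-bound {k} {q} {b} {c} {d} {K} {L} {n} 1≤q kL≤ b≤L kK≤n = begin
  k ℕ.* b ℕ.* (K ℕ.+ n ℕ.* L)                          ≡⟨ eq₁ k b K n L ⟩
  b ℕ.* (k ℕ.* K) ℕ.+ b ℕ.* n ℕ.* (k ℕ.* L)            ≤⟨ ℕ.+-mono-≤ (ℕ.*-monoʳ-≤ b kK≤n) (ℕ.*-monoʳ-≤ (b ℕ.* n) kL≤) ⟩
  b ℕ.* n ℕ.+ b ℕ.* n ℕ.* (q ℕ.* d ℕ.+ c)              ≡⟨ eq₂ b n q d c ⟩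
  q ℕ.* b ℕ.* (n ℕ.* d) ℕ.+ n ℕ.* ((1 ℕ.+ c) ℕ.* b)    ≤⟨ ℕ.+-monoʳ-≤ (q ℕ.* b ℕ.* (n ℕ.* d)) (ℕ.≤-trans (ℕ.*-monoʳ-≤ n b≤L) (ℕ.≤-trans (ℕ.m≤n+m _ K) T≤qT)) ⟩
  q ℕ.* b ℕ.* (n ℕ.* d) ℕ.+ q ℕ.* (K ℕ.+ n ℕ.* L)      ∎
  where
  open ℕ.≤-Reasoning
  T≤qT : K ℕ.+ n ℕ.* L ≤ q ℕ.* (K ℕ.+ n ℕ.* L)
  T≤qT = ℕ.≤-trans (ℕ.≤-reflexive (sym (ℕ.*-identityˡ _))) (ℕ.*-monoˡ-≤ (K ℕ.+ n ℕ.* L) 1≤q)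
  eq₁ : ∀ k b K n L → k ℕ.* b ℕ.* (K ℕ.+ n ℕ.* L) ≡ b ℕ.* (k ℕ.* K) ℕ.+ b ℕ.* n ℕ.* (k ℕ.* L)
  eq₁ = solve-∀
  eq₂ : ∀ b n q d c → b ℕ.* n ℕ.+ b ℕ.* n ℕ.* (q ℕ.* d ℕ.+ c) ≡ q ℕ.* b ℕ.* (n ℕ.* d) ℕ.+ n ℕ.* ((1 ℕ.+ c) ℕ.* b)
  eq₂ = solve-∀

-- The bound on the ratio for given points `p`, `s`, `b`.

bijRatio-lower : ∀ {v} (dst : Fin (suc v) → Fin (suc v) → ℕ) →
  (∀ i j → dst i j ≤ ∣ toℕ i - toℕ j ∣) →
  ∀ {k d c q} .{{_ : NonZero q}} ε → 0ℚ < ε → 1 ≤ d → v ≤ q ℕ.* d ℕ.+ c →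
  (1 ℕ.+ (c ℕ.+ suc k)) ℕ.* ℚ.↧ₙ ε ℕ.* suc k ≤ v →
  ∀ {b p s} → dst p s ≡ d → dst s p ≡ d → d ℕ.< dst b p → d ℕ.< dst b s →
  ∀ g → BijRatioAtLeast (record { V = suc v ; dist = dst }) (suc k) g (p ∷ replicate k b) ((+ suc k / q) - ε)
bijRatio-lower {v} dst dst≤ {k₀} {d} {c} {q@(suc _)} ε 0<ε 1≤d v≤ v≥ {b} {p} {s} ps sp bp bs g ρ (n₀ , bij) =
  ratio-bound k q ε 0<ε ρ (ℕ.*-mono-≤ {1} {n} (s≤s z≤n) 1≤d)
    (alternating≤greedy M g b [] p s ps sp bp bs n)
    (optCost-upper dst dst≤ v<kL (p ∷ replicate k₀ b) (Bijection.to (proj₁ (bij n n₀≤n)) σ))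
    (proj₂ (bij n n₀≤n) σ)
    (cleared-bound {k} {q} {ℚ.↧ₙ ε} {c ℕ.+ k} {d} {k ℕ.* v} {L} {n} (s≤s z≤n) kL≤ b≤L (ℕ.m≤n⇒m≤1+n (ℕ.m≤n+m _ n₀)))
  where
  M = record { V = suc v ; dist = dst }
  k = suc k₀
  -- Long enough to reach `n₀` and to make `k` times the startup cost `k * v` at most `n`; the
  -- successor keeps the bound on GREEDY positive.
  n = suc (n₀ ℕ.+ k ℕ.* (k ℕ.* v))
  -- Rounding up makes `k` blocks cover all vertices and raises the error from `c` to `c + k`.
  L = suc (v ℕ./ k)
  σ = alternating M k p s n

  n₀≤n : n₀ ≤ n
  n₀≤n = ℕ.m≤n⇒m≤1+n (ℕ.m≤m+n n₀ _)

  v<kL : v ℕ.< k ℕ.* L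
  v<kL = begin-strict
    v                          ≡⟨ m≡m%n+[m/n]*n v k ⟩
    v ℕ.% k ℕ.+ v ℕ./ k ℕ.* k  <⟨ ℕ.+-monoˡ-< _ (m%n<n v k) ⟩
    L ℕ.* k                    ≡⟨ ℕ.*-comm L k ⟩
    k ℕ.* L                    ∎
    where open ℕ.≤-Reasoning

  kL≤ : k ℕ.* L ≤ q ℕ.* d ℕ.+ (c ℕ.+ k)
  kL≤ = begin
    k ℕ.* L                  ≡⟨ ℕ.*-comm k L ⟩
    k ℕ.+ v ℕ./ k ℕ.* k      ≡⟨ ℕ.+-comm k _ ⟩
    v ℕ./ k ℕ.* k ℕ.+ k      ≤⟨ ℕ.+-monoˡ-≤ k (ℕ.≤-trans (m/n*n≤m v k) v≤) ⟩
    q ℕ.* d ℕ.+ c ℕ.+ k      ≡⟨ ℕ.+-assoc (q ℕ.* d) c k ⟩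
    q ℕ.* d ℕ.+ (c ℕ.+ k)    ∎
    where open ℕ.≤-Reasoning

  b≤L : (1 ℕ.+ (c ℕ.+ k)) ℕ.* ℚ.↧ₙ ε ≤ L
  b≤L = ℕ.m≤n⇒m≤1+n (subst (ℕ._≤ v ℕ./ k) (m*n/n≡m _ k) (/-monoˡ-≤ k v≥))

-- Placement of the points on the line and on the circle.

-- N is cut into r arcs of length m and one strictly shorter arc of length d ≈ N/(r+1);
-- the line uses r = 1, the circle r = 2.
split-arcs : ∀ r N → suc r ℕ.* r ≤ N → ∃[ m ] ∃[ d ]
  (N ≡ r ℕ.* m ℕ.+ d) × (d ℕ.< m) × (N ≤ suc r ℕ.* d ℕ.+ suc r ℕ.* r)
split-arcs r N large = m , d , eq , d<m , N≤
  where
  open ℕ.≤-Reasoning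
  t = N ℕ./ suc r
  -- Rounding strictly above `N / (r + 1)` is what makes the leftover arc shorter than `m`.
  m = suc t
  d = N ℕ.∸ r ℕ.* m

  -- This yields `r * m ≤ N`, so the subtraction in `d` is not truncated.
  r≤t : r ≤ t
  r≤t = subst (ℕ._≤ t) (m*n/n≡m r (suc r))
    (/-monoˡ-≤ (suc r) (subst (ℕ._≤ N) (ℕ.*-comm (suc r) r) large))

  rm≤N : r ℕ.* m ≤ N
  rm≤N = begin
    r ℕ.* suc t       ≡⟨ ℕ.*-suc r t ⟩
    r ℕ.+ r ℕ.* t     ≤⟨ ℕ.+-monoˡ-≤ (r ℕ.* t) r≤t ⟩
    suc r ℕ.* t       ≡⟨ ℕ.*-comm (suc r) t ⟩
    t ℕ.* suc r       ≤⟨ m/n*n≤m N (suc r) ⟩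
    N                 ∎

  eq : N ≡ r ℕ.* m ℕ.+ d
  eq = sym (ℕ.m+[n∸m]≡n rm≤N)

  d<m : d ℕ.< m
  d<m = ℕ.+-cancelˡ-< (r ℕ.* m) d m (begin-strict
    r ℕ.* m ℕ.+ d                 ≡⟨ eq ⟨
    N                             ≡⟨ m≡m%n+[m/n]*n N (suc r) ⟩
    N ℕ.% suc r ℕ.+ t ℕ.* suc r   <⟨ ℕ.+-monoˡ-< _ (m%n<n N (suc r)) ⟩
    m ℕ.* suc r                   ≡⟨ ℕ.*-comm m (suc r) ⟩
    m ℕ.+ r ℕ.* m                 ≡⟨ ℕ.+-comm m _ ⟩
    r ℕ.* m ℕ.+ m                 ∎)

  N≤ : N ≤ suc r ℕ.* d ℕ.+ suc r ℕ.* r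
  N≤ = ℕ.+-cancelˡ-≤ (r ℕ.* N) N _ (begin
    r ℕ.* N ℕ.+ N                                             ≡⟨ ℕ.+-comm (r ℕ.* N) N ⟩
    suc r ℕ.* N                                               ≡⟨ cong (suc r ℕ.*_) eq ⟩
    suc r ℕ.* (r ℕ.* suc t ℕ.+ d)                             ≡⟨ rearrange r t d ⟩
    r ℕ.* (t ℕ.* suc r) ℕ.+ (suc r ℕ.* d ℕ.+ suc r ℕ.* r)
      ≤⟨ ℕ.+-monoˡ-≤ _ (ℕ.*-monoʳ-≤ r (m/n*n≤m N (suc r))) ⟩
    r ℕ.* N ℕ.+ (suc r ℕ.* d ℕ.+ suc r ℕ.* r)                 ∎)
    where
    rearrange : ∀ r t d → suc r ℕ.* (r ℕ.* suc t ℕ.+ d) ≡ r ℕ.* (t ℕ.* suc r) ℕ.+ (suc r ℕ.* d ℕ.+ suc r ℕ.* r)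
    rearrange = solve-∀

shorter-arc-pos : ∀ {N q d c} → 1 ℕ.+ c ≤ N → N ≤ q ℕ.* d ℕ.+ c → 1 ≤ d
shorter-arc-pos {d = suc d}     _     _  = s≤s z≤n
shorter-arc-pos {N} {q} {zero} {c} large N≤ =
  contradiction (ℕ.≤-trans large (subst (λ x → N ≤ x ℕ.+ c) (ℕ.*-zeroʳ q) N≤)) (ℕ.<-irrefl refl)

-- `c` is the error of `split-arcs`. The first summand forces `d` to be positive, the second makes
-- blocks long compared with the denominator of `ε`.
threshold : ℕ → ℕ → ℚ → ℕ
threshold c k ε = (1 ℕ.+ c) ℕ.+ (1 ℕ.+ (c ℕ.+ k)) ℕ.* ℚ.↧ₙ ε ℕ.* k

-- The idle servers stand at the end `0`, `p` at `m` near the middle and `s` at the other end;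
-- `d < m` keeps `0` farther than `d` from both.
line-lower : ∀ k ε → 0ℚ < ε → ∀ N → threshold 2 (suc k) ε ≤ N →
  ∃[ C₀ ] ∀ (g : GreedyRule (line N) (suc k)) →
    BijRatioAtLeast (line N) (suc k) g C₀ ((+ suc k / 2) - ε)
line-lower k ε 0<ε N N₀≤N with split-arcs 1 N (ℕ.≤-trans (ℕ.m≤n⇒m≤1+n ℕ.≤-refl) (ℕ.m+n≤o⇒m≤o 3 N₀≤N))
... | m , d , N≡ , d<m , N≤ = p ∷ replicate k Fin.zero ,
  bijRatio-lower (dist (line N)) (λ _ _ → ℕ.≤-refl) {k} {d} {2} {2} ε 0<ε
    (shorter-arc-pos {N} {2} (ℕ.m+n≤o⇒m≤o 3 N₀≤N) N≤) N≤ (ℕ.m+n≤o⇒n≤o 3 N₀≤N)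
    ps (trans (ℕ.∣-∣-comm (toℕ s) (toℕ p)) ps)
    (subst (d ℕ.<_) (sym toℕ-p) d<m)
    (subst (d ℕ.<_) (sym toℕ-s) (ℕ.<-≤-trans d<m (ℕ.m≤m+n m d)))
  where
  N≡m+d : N ≡ m ℕ.+ d
  N≡m+d = trans N≡ (cong (ℕ._+ d) (ℕ.*-identityˡ m))

  m<1+N : m ℕ.< suc N
  m<1+N = s≤s (subst (m ≤_) (sym N≡m+d) (ℕ.m≤m+n m d))

  p s : Fin (suc N)
  p = fromℕ< m<1+N
  s = Fin.fromℕ N

  toℕ-p : toℕ p ≡ m
  toℕ-p = Fin.toℕ-fromℕ< m<1+N

  toℕ-s : toℕ s ≡ m ℕ.+ d
  toℕ-s = trans (Fin.toℕ-fromℕ N) N≡m+d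

  ps : ∣ toℕ p - toℕ s ∣ ≡ d
  ps = trans (cong₂ ∣_-_∣ toℕ-p toℕ-s) (ℕ.∣m-m+n∣≡n m d)

-- The points `0`, `m`, `m + d` cut the cycle into arcs `m`, `d`, `m`. From the idle servers at `0`,
-- either way round to `p` or `s` is longer than `d`. The threshold is one higher because cutting
-- the cycle open leaves a path with `N - 1` edges.
circle-lower : ∀ k ε → 0ℚ < ε → ∀ N → suc (threshold 6 (suc k) ε) ≤ N →
  ∃[ C₀ ] ∀ (g : GreedyRule (circle N) (suc k)) →
    BijRatioAtLeast (circle N) (suc k) g C₀ ((+ suc k / 3) - ε)
circle-lower k ε 0<ε N@(suc v) (s≤s N₀≤v)
  with split-arcs 2 N (ℕ.≤-trans (ℕ.m≤n⇒m≤1+n ℕ.≤-refl) (ℕ.m≤n⇒m≤1+n (ℕ.m+n≤o⇒m≤o 7 N₀≤v)))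
... | m , d , N≡ , d<m , N≤ = p ∷ replicate k Fin.zero ,
  bijRatio-lower (dist (circle N)) (λ _ _ → ℕ.m⊓n≤m _ _) {k} {d} {6} {3} ε 0<ε
    (shorter-arc-pos {N} {3} (ℕ.m≤n⇒m≤1+n (ℕ.m+n≤o⇒m≤o 7 N₀≤v)) N≤)
    (ℕ.≤-trans (ℕ.n≤1+n v) N≤) (ℕ.m+n≤o⇒n≤o 7 N₀≤v)
    ps (trans (cong (λ x → x ℕ.⊓ (N ℕ.∸ x)) (ℕ.∣-∣-comm (toℕ s) (toℕ p))) ps)
    (subst (λ x → d ℕ.< x ℕ.⊓ (N ℕ.∸ x)) (sym toℕ-p)
      (ℕ.⊓-pres-m< d<m (subst (d ℕ.<_) (sym N∸m) d<m+d)))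
    (subst (λ x → d ℕ.< x ℕ.⊓ (N ℕ.∸ x)) (sym toℕ-s)
      (ℕ.⊓-pres-m< d<m+d (subst (d ℕ.<_) (sym N∸[m+d]) d<m)))
  where
  arcs : ∀ m d → 2 ℕ.* m ℕ.+ d ≡ m ℕ.+ d ℕ.+ m
  arcs = solve-∀

  N≡m+d+m : N ≡ m ℕ.+ d ℕ.+ m
  N≡m+d+m = trans N≡ (arcs m d)

  N∸[m+d] : N ℕ.∸ (m ℕ.+ d) ≡ m
  N∸[m+d] = trans (cong (ℕ._∸ (m ℕ.+ d)) N≡m+d+m) (ℕ.m+n∸m≡n (m ℕ.+ d) m)

  N∸m : N ℕ.∸ m ≡ m ℕ.+ d
  N∸m = trans (cong (ℕ._∸ m) N≡m+d+m) (ℕ.m+n∸n≡m (m ℕ.+ d) m)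

  d<m+d : d ℕ.< m ℕ.+ d
  d<m+d = ℕ.<-≤-trans d<m (ℕ.m≤m+n m d)

  m+d<N : m ℕ.+ d ℕ.< N
  m+d<N = subst (m ℕ.+ d ℕ.<_) (sym N≡m+d+m) (ℕ.m<m+n (m ℕ.+ d) (ℕ.≤-<-trans z≤n d<m))

  m<N : m ℕ.< N
  m<N = ℕ.≤-<-trans (ℕ.m≤m+n m d) m+d<N

  p s : Fin N
  p = fromℕ< m<N
  s = fromℕ< m+d<N

  toℕ-p : toℕ p ≡ m
  toℕ-p = Fin.toℕ-fromℕ< m<N

  toℕ-s : toℕ s ≡ m ℕ.+ d
  toℕ-s = Fin.toℕ-fromℕ< m+d<N

  -- The arc of length `d` is at most half the cycle, so the minimum in the distance is `d`.
  d≤N∸d : d ≤ N ℕ.∸ d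
  d≤N∸d = ℕ.m+n≤o⇒m≤o∸n d (ℕ.≤-trans (ℕ.+-monoˡ-≤ d (ℕ.<⇒≤ d<m)) (ℕ.<⇒≤ m+d<N))

  ps : dist (circle N) p s ≡ d
  ps = trans
    (cong (λ x → x ℕ.⊓ (N ℕ.∸ x)) (trans (cong₂ ∣_-_∣ toℕ-p toℕ-s) (ℕ.∣m-m+n∣≡n m d)))
    (ℕ.m≤n⇒m⊓n≡m d≤N∸d)

theorem7 : (k : ℕ) → 1 ≤ k → (ε : ℚ) → 0ℚ < ε →
    (∃[ N₀ ] ∀ N → N₀ ≤ N → ∃[ C₀ ] ∀ (g : GreedyRule (line N) k) →
    BijRatioAtLeast (line N) k g C₀ ((+ k / 2) - ε))
    × (∃[ N₀ ] ∀ N → N₀ ≤ N → ∃[ C₀ ] ∀ (g : GreedyRule (circle N) k) →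
    BijRatioAtLeast (circle N) k g C₀ ((+ k / 3) - ε))
theorem7 (suc k) _ ε 0<ε =
  (threshold 2 (suc k) ε , line-lower k ε 0<ε) ,
  (suc (threshold 6 (suc k) ε) , circle-lower k ε 0<ε)
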